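{- Let $\mathcal{M}_i=(E_i,\rho_i)$, $i=1,2$, be $q$-matroids, let $\mathcal{F}_i$ and $\mathcal{Z}_i$ be the collections of flats and of cyclic flats of $\mathcal{M}_i$, and let $\rho$ be the rank function of $\mathcal{M}_1\oplus\mathcal{M}_2$ on $E=E_1\oplus E_2$. Then for all subspaces $V\le E$, \[ \rho(V)=\dim V+\min_{F_1\in\mathcal{F}_1,F_2\in\mathcal{F}_2}\big(\rho_1(F_1)+\rho_2(F_2)-\dim((F_1\oplus F_2)\cap V)\big) =\dim V+\min_{Z_1\in\mathcal{Z}_1,Z_2\in\mathcal{Z}_2}\big(\rho_1(Z_1)+\rho_2(Z_2)-\dim((Z_1\oplus Z_2)\cap V)\big). \]
   Context: Let $\mathbb{F}=\mathbb{F}_q$. A $q$-matroid is $\mathcal{M}=(E,\rho)$, $E$ a finite-dimensional $\mathbb{F}$-vector space, $\rho$ from subspaces to $\mathbb{Z}_{\ge0}$ with $0\le\rho(V)\le\dim V$, monotone and submodular. A flat is $F$ with $\rho(F+\langle x\rangle)>\rho(F)$ for all $x\notin F$. The cyclic core is $\mathrm{cyc}(V)=\{x\in V\mid\rho(W)=\rho(V)\text{ for all }W\le V\text{ with }W+\langle x\rangle=V\}$; $V$ is cyclic if $\mathrm{cyc}(V)=V$; a cyclic flat is a flat that is cyclic. Direct sum: for $E=E_1\oplus E_2$ (each $E_i$ identified with its image) with projections $\pi_i:E\to E_i$, $\mathcal{M}_1\oplus\mathcal{M}_2=(E,\rho)$ where $\rho(V)=\dim V+\min_{X\le V}(\rho_1(\pi_1(X))+\rho_2(\pi_2(X))-\dim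 X)$. -}

module Defs where

open import Algebra.Bundles using (CommutativeMonoid; CommutativeRing; Ring)
open import Algebra.Module.Bundles using (LeftModule)
open import Algebra.Module.Construct.DirectProduct using (leftModule)
import Algebra.Properties.CommutativeMonoid.Sum as Sum
import Algebra.Properties.Group as GroupProperties
import Algebra.Properties.Ring as RingProperties
open import Data.Bool.Base using (Bool; T)
open import Data.Fin.Base using (Fin; zero; suc; toℕ; fromℕ<; combine; remQuot; finToFun; funToFin)
open import Data.Fin.Properties as Fin
  using (any?; all?; inj⇒≟; injective⇒≤; finToFun-funToFin; remQuot-combine; toℕ-fromℕ<)
open import Data.Integer.Base as ℤ using (ℤ; +_)
import Data.Integer.Properties as ℤ
open import Data.List.Base using (List; concatMap; tabulate; filter; allFin)
import Data.List.Extrema as Extrema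
open import Data.List.Membership.Propositional using () renaming (_∈_ to _∈ˡ_)
open import Data.List.Membership.Propositional.Properties
  using (∈-concatMap⁺; ∈-tabulate⁺; ∈-filter⁺; ∈-allFin)
import Data.List.Relation.Unary.All as All
import Data.List.Relation.Unary.All.Properties as All
import Data.List.Relation.Unary.Any as Any
open import Data.Nat.Base as ℕ using (ℕ; zero; suc; _^_; _≤_; _<_; s≤s; z≤n)
import Data.Nat.Properties as ℕ
open import Data.Product using (∃; ∃₂; ∃-syntax; _×_; _,_; proj₁; proj₂)
open import Data.Unit.Base using (tt)
open import Data.Vec.Functional using (Vector; []; _∷_)
open import Function.Base using (_∘_; const)
open import Function.Bundles using (Inverse; Injection)
open import Function.Properties.Inverse using (Inverse⇒Injection)
import Function.Construct.Symmetry as Symmetry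
open import Level using (Level; _⊔_; 0ℓ) renaming (suc to lsuc)
open import Relation.Binary.Definitions using (_Respects_) renaming (Decidable to Decidable₂)
open import Relation.Binary.PropositionalEquality as ≡ using (_≡_; refl; cong; cong₂; subst)
import Relation.Binary.Reasoning.Setoid as SetoidReasoning
open import Relation.Nullary using (¬_; Dec; yes; no; contradiction)
open import Relation.Nullary.Decidable using (map′; _×-dec_; _→-dec_; ⌊_⌋; T?; toWitness; fromWitness)
open import Relation.Unary using (Pred; Decidable; U; _⟨×⟩_; _∈_; _∉_; _⊆_; _≐_)

private
  variable
    a c ℓ m ℓm m₁ ℓ₁ m₂ ℓ₂ p : Level

record FiniteField c ℓ : Set (lsuc (c ⊔ ℓ)) where
  field
    commutativeRing : CommutativeRing c ℓ

  open CommutativeRing commutativeRing public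

  field
    0≉1         : ¬ 0# ≈ 1#
    invertible  : ∀ {x} → ¬ x ≈ 0# → ∃[ y ] x * y ≈ 1#
    order       : ℕ
    enumeration : Inverse (≡.setoid (Fin order)) setoid

  element : Fin order → Carrier
  element = Inverse.to enumeration

  index : Carrier → Fin order
  index = Inverse.from enumeration

  element-index : ∀ x → element (index x) ≈ x
  element-index = Inverse.strictlyInverseˡ enumeration

  _≟_ : Decidable₂ _≈_
  _≟_ = inj⇒≟ (Inverse⇒Injection (Symmetry.inverse enumeration))

module _ {R : Ring c ℓ} (M : LeftModule R m ℓm) where

  open Ring R using (Carrier; _≈_; 0#)
  open LeftModule M

  linComb : ∀ {n} → Vector Carrier n → Vector Carrierᴹ n → Carrierᴹ
  linComb a v = Sum.sum +ᴹ-commutativeMonoid (λ i → a i *ₗ v i)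

  Span : ∀ {n} → Vector Carrierᴹ n → Pred Carrierᴹ (c ⊔ ℓm)
  Span v x = ∃[ a ] x ≈ᴹ linComb a v

  LinearlyIndependent : ∀ {n} → Vector Carrierᴹ n → Set (c ⊔ ℓ ⊔ ℓm)
  LinearlyIndependent v = ∀ a → linComb a v ≈ᴹ 0ᴹ → ∀ i → a i ≈ 0#

  record IsBasis {n} (P : Pred Carrierᴹ p) (v : Vector Carrierᴹ n) : Set (c ⊔ ℓ ⊔ m ⊔ ℓm ⊔ p) where
    field
      contained   : ∀ i → v i ∈ P
      independent : LinearlyIndependent v
      spanning    : P ⊆ Span v

record VectorSpace (K : FiniteField c ℓ) m ℓm : Set (c ⊔ ℓ ⊔ lsuc (m ⊔ ℓm)) where
  field
    module′ : LeftModule (FiniteField.ring K) m ℓm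

  open LeftModule module′ public

  field
    dimension : ℕ
    basis     : Vector Carrierᴹ dimension
    isBasis   : IsBasis module′ U basis

module LinComb {R : Ring c ℓ} (M : LeftModule R m ℓm) where

  open Ring R using (Carrier; _≈_; 0#; 1#; _+_; _*_; -_)
  open LeftModule M
  private
    module R = Ring R
    module S = Sum +ᴹ-commutativeMonoid

  linComb-cong : ∀ {n} {a b : Vector Carrier n} {v w : Vector Carrierᴹ n} →
                 (∀ i → a i ≈ b i) → (∀ i → v i ≈ᴹ w i) → linComb M a v ≈ᴹ linComb M b w
  linComb-cong a≈b v≈w = S.sum-cong-≋ (λ i → *ₗ-cong (a≈b i) (v≈w i))

  linComb-+ : ∀ {n} (a b : Vector Carrier n) v →
              linComb M (λ i → a i + b i) v ≈ᴹ linComb M a v +ᴹ linComb M b v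
  linComb-+ a b v = ≈ᴹ-trans (S.sum-cong-≋ (λ i → *ₗ-distribʳ (v i) (a i) (b i)))
                             (S.∑-distrib-+ (λ i → a i *ₗ v i) (λ i → b i *ₗ v i))

  linComb-* : ∀ {n} k (a : Vector Carrier n) v →
              linComb M (λ i → k * a i) v ≈ᴹ k *ₗ linComb M a v
  linComb-* {zero}  k a v = ≈ᴹ-sym (*ₗ-zeroʳ k)
  linComb-* {suc n} k a v =
    ≈ᴹ-trans (+ᴹ-cong (*ₗ-assoc k _ _) (linComb-* k (a ∘ suc) (v ∘ suc)))
             (≈ᴹ-sym (*ₗ-distribˡ k _ _))

  linComb-0 : ∀ {n} (v : Vector Carrierᴹ n) → linComb M (const 0#) v ≈ᴹ 0ᴹ
  linComb-0 {n} v = ≈ᴹ-trans (S.sum-cong-≋ (λ i → *ₗ-zeroˡ (v i))) (S.sum-replicate-zero n)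

  -1*ₗ : ∀ x → (- 1#) *ₗ x ≈ᴹ -ᴹ x
  -1*ₗ x = GroupProperties.inverseˡ-unique +ᴹ-group _ _ (begin
    (- 1#) *ₗ x +ᴹ x        ≈⟨ +ᴹ-congˡ (≈ᴹ-sym (*ₗ-identityˡ x)) ⟩
    (- 1#) *ₗ x +ᴹ 1# *ₗ x  ≈⟨ ≈ᴹ-sym (*ₗ-distribʳ x _ _) ⟩
    (- 1# + 1#) *ₗ x        ≈⟨ *ₗ-congʳ (R.-‿inverseˡ 1#) ⟩
    0# *ₗ x                 ≈⟨ *ₗ-zeroˡ x ⟩
    0ᴹ                      ∎)
    where open SetoidReasoning ≈ᴹ-setoid

module FiniteModule (K : FiniteField c ℓ) (M : LeftModule (FiniteField.ring K) m ℓm) where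

  open FiniteField K using (Carrier; _≈_; 0#; 1#; _+_; _*_; -_; order; element; index; element-index)
  open LeftModule M
  open LinComb M
  private module K = FiniteField K

  coefficients : ∀ {n} → Fin (order ^ n) → Vector Carrier n
  coefficients i = element ∘ finToFun i

  code : ∀ {n} → Vector Carrier n → Fin (order ^ n)
  code a = funToFin (index ∘ a)

  coefficients-code : ∀ {n} (a : Vector Carrier n) i → coefficients (code a) i ≈ a i
  coefficients-code a i =
    K.trans (K.reflexive (cong element (finToFun-funToFin (index ∘ a) i))) (element-index (a i))

  linComb-code : ∀ {n} (a : Vector Carrier n) v → linComb M a v ≈ᴹ linComb M (coefficients (code a)) v
  linComb-code a v = linComb-cong (λ i → K.sym (coefficients-code a i)) (λ _ → ≈ᴹ-refl)

  linComb-injective : ∀ {n} {v : Vector Carrierᴹ n} → LinearlyIndependent M v →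
                      ∀ a b → linComb M a v ≈ᴹ linComb M b v → ∀ i → a i ≈ b i
  linComb-injective {v = v} ind a b eq i =
    GroupProperties.x∙y⁻¹≈ε⇒x≈y K.+-group _ _
      (K.trans (K.+-congˡ (K.sym (RingProperties.-1*x≈-x K.ring (b i))))
               (ind (λ j → a j + (- 1#) * b j) (begin
      linComb M (λ j → a j + (- 1#) * b j) v             ≈⟨ linComb-+ a (λ j → (- 1#) * b j) v ⟩
      linComb M a v +ᴹ linComb M (λ j → (- 1#) * b j) v  ≈⟨ +ᴹ-cong eq (linComb-* (- 1#) b v) ⟩
      linComb M b v +ᴹ (- 1#) *ₗ linComb M b v           ≈⟨ +ᴹ-congˡ (-1*ₗ _) ⟩
      linComb M b v +ᴹ -ᴹ linComb M b v                  ≈⟨ -ᴹ‿inverseʳ _ ⟩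
      0ᴹ                                                 ∎) i))
    where open SetoidReasoning ≈ᴹ-setoid

  linComb-closed : ∀ {P : Pred Carrierᴹ p} → P Respects _≈ᴹ_ → 0ᴹ ∈ P →
                   (∀ {x y} → x ∈ P → y ∈ P → (x +ᴹ y) ∈ P) →
                   (∀ k {x} → x ∈ P → (k *ₗ x) ∈ P) →
                   ∀ {n} (a : Vector Carrier n) {v} → (∀ i → v i ∈ P) → linComb M a v ∈ P
  linComb-closed resp 0∈ +∈ *∈ {zero}  a v∈ = 0∈
  linComb-closed resp 0∈ +∈ *∈ {suc n} a v∈ =
    +∈ (*∈ (a zero) (v∈ zero)) (linComb-closed resp 0∈ +∈ *∈ (a ∘ suc) (v∈ ∘ suc))

  Span-resp : ∀ {n} (v : Vector Carrierᴹ n) → Span M v Respects _≈ᴹ_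
  Span-resp v x≈y (a , eq) = a , ≈ᴹ-trans (≈ᴹ-sym x≈y) eq

  Span-0 : ∀ {n} (v : Vector Carrierᴹ n) → 0ᴹ ∈ Span M v
  Span-0 v = const 0# , ≈ᴹ-sym (linComb-0 v)

  Span-+ : ∀ {n} (v : Vector Carrierᴹ n) {x y} → x ∈ Span M v → y ∈ Span M v → (x +ᴹ y) ∈ Span M v
  Span-+ v (a , p) (b , q) =
    (λ i → a i + b i) , ≈ᴹ-trans (+ᴹ-cong p q) (≈ᴹ-sym (linComb-+ a b v))

  Span-* : ∀ {n} (v : Vector Carrierᴹ n) k {x} → x ∈ Span M v → (k *ₗ x) ∈ Span M v
  Span-* v k (a , p) = (λ i → k * a i) , ≈ᴹ-trans (*ₗ-congˡ p) (≈ᴹ-sym (linComb-* k a v))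

  1<order : 1 < order
  1<order with order | index 0# | index 1# | K.trans (K.sym (element-index 0#)) ∘ (λ eq → K.trans (K.reflexive (cong element eq)) (element-index 1#))
  ... | suc zero    | zero | zero | f = contradiction (f refl) K.0≉1
  ... | suc (suc _) | _    | _    | _ = s≤s (s≤s z≤n)

  abstract
    independent≤spanning : ∀ {n k} {v : Vector Carrierᴹ n} {w : Vector Carrierᴹ k} →
                           LinearlyIndependent M v → (∀ i → v i ∈ Span M w) → n ≤ k
    independent≤spanning {n} {k} {v} {w} ind v∈ =
      ℕ.≮⇒≥ (λ k<n → ℕ.<⇒≱ (ℕ.^-monoʳ-< order 1<order k<n) (injective⇒≤ recode-injective))
      where
      comb∈ : ∀ a → linComb M a v ∈ Span M w
      comb∈ a = linComb-closed (Span-resp w) (Span-0 w) (Span-+ w) (Span-* w) a v∈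

      recode : Fin (order ^ n) → Fin (order ^ k)
      recode i = code (proj₁ (comb∈ (coefficients i)))

      recode-spec : ∀ i → linComb M (coefficients i) v ≈ᴹ linComb M (coefficients (recode i)) w
      recode-spec i = ≈ᴹ-trans (proj₂ (comb∈ (coefficients i))) (linComb-code _ w)

      funToFin-cong : ∀ {j} {f g : Fin j → Fin order} → (∀ i → f i ≡ g i) → funToFin f ≡ funToFin g
      funToFin-cong {zero}  eq = refl
      funToFin-cong {suc j} eq = cong₂ combine (eq zero) (funToFin-cong (eq ∘ suc))

      recode-injective : ∀ {i j} → recode i ≡ recode j → i ≡ j
      recode-injective {i} {j} eq = ≡.trans (≡.sym (Fin.funToFin-finToFin {n} i))
        (≡.trans (funToFin-cong (λ h → Injection.injective (Inverse⇒Injection K.enumeration)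
          (linComb-injective ind (coefficients i) (coefficients j)
            (≈ᴹ-trans (recode-spec i) (≈ᴹ-trans
              (≈ᴹ-reflexive (cong (λ r → linComb M (coefficients r) w) eq))
              (≈ᴹ-sym (recode-spec j)))) h)))
          (Fin.funToFin-finToFin {n} j))

record IsFinite {R : Ring c ℓ} (M : LeftModule R m ℓm) : Set (m ⊔ ℓm) where
  open LeftModule M
  field
    _≟ᴹ_    : Decidable₂ _≈ᴹ_
    size    : ℕ
    vector  : Fin size → Carrierᴹ
    covered : ∀ x → ∃[ i ] vector i ≈ᴹ x

  ∃? : ∀ {P : Pred Carrierᴹ p} → P Respects _≈ᴹ_ → Decidable P → Dec (∃ P)
  ∃? resp P? = map′ (λ (i , p) → vector i , p)
                    (λ (x , p) → let (i , eq) = covered x in i , resp (≈ᴹ-sym eq) p)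
                    (any? (P? ∘ vector))

module BasisExistence (K : FiniteField c ℓ) {M : LeftModule (FiniteField.ring K) m ℓm}
                      (fin : IsFinite M) where

  open FiniteField K using (Carrier; _≈_; 0#; 1#; _+_; _*_; -_; _≟_)
  open LeftModule M
  open LinComb M
  open FiniteModule K M
  open IsFinite fin
  private module K = FiniteField K

  Span? : ∀ {n} (v : Vector Carrierᴹ n) → Decidable (Span M v)
  Span? v x = map′ (λ (i , eq) → coefficients i , eq)
                   (λ (a , eq) → code a , ≈ᴹ-trans eq (linComb-code a v))
                   (any? (λ i → x ≟ᴹ linComb M (coefficients i) v))

  Span-member : ∀ {n} (v : Vector Carrierᴹ (suc n)) → v zero ∈ Span M v
  Span-member v = (1# ∷ const 0#) ,
    ≈ᴹ-sym (≈ᴹ-trans (+ᴹ-cong (*ₗ-identityˡ _) (linComb-0 (v ∘ suc))) (+ᴹ-identityʳ _))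

  Span-weaken : ∀ {n} x (v : Vector Carrierᴹ n) → Span M v ⊆ Span M (x ∷ v)
  Span-weaken x v (a , eq) = (0# ∷ a) ,
    ≈ᴹ-trans eq (≈ᴹ-sym (≈ᴹ-trans (+ᴹ-congʳ (*ₗ-zeroˡ x)) (+ᴹ-identityˡ _)))

  ∷-independent : ∀ {n} {x} {v : Vector Carrierᴹ n} → LinearlyIndependent M v →
                  x ∉ Span M v → LinearlyIndependent M (x ∷ v)
  ∷-independent {x = x} {v} ind x∉ a eq = λ where
      zero    → a₀≈0
      (suc i) → ind (a ∘ suc) (≈ᴹ-trans
                  (≈ᴹ-sym (≈ᴹ-trans (+ᴹ-congʳ (≈ᴹ-trans (*ₗ-congʳ a₀≈0) (*ₗ-zeroˡ x))) (+ᴹ-identityˡ _))) eq) i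
    where
    open SetoidReasoning ≈ᴹ-setoid
    a₀ = a zero
    a₀≈0 : a₀ ≈ 0#
    a₀≈0 with a₀ ≟ 0#
    ... | yes a₀≈0 = a₀≈0
    ... | no  a₀≉0 = let (b , a₀b≈1) = K.invertible a₀≉0 in contradiction
      (Span-resp v (begin
        b *ₗ ((- 1#) *ₗ linComb M (a ∘ suc) v)  ≈⟨ *ₗ-congˡ (-1*ₗ _) ⟩
        b *ₗ (-ᴹ linComb M (a ∘ suc) v)         ≈⟨ *ₗ-congˡ (GroupProperties.inverseˡ-unique +ᴹ-group _ _ eq) ⟨
        b *ₗ (a₀ *ₗ x)                          ≈⟨ *ₗ-assoc b a₀ x ⟨
        (b * a₀) *ₗ x                           ≈⟨ *ₗ-congʳ (K.trans (K.*-comm b a₀) a₀b≈1) ⟩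
        1# *ₗ x                                 ≈⟨ *ₗ-identityˡ x ⟩
        x                                       ∎)
        (Span-* v b (Span-* v (- 1#) ((a ∘ suc) , ≈ᴹ-refl))))
      x∉

  abstract
    basis-exists : ∀ {P : Pred Carrierᴹ p} → P Respects _≈ᴹ_ → Decidable P →
                   ∃₂ λ n (v : Vector Carrierᴹ n) → IsBasis M P v
    basis-exists {P = P} resp P? =
      let (n , v , v∈ , ind , covers) = greedy vector in
      n , v , record
        { contained   = v∈
        ; independent = ind
        ; spanning    = λ {x} x∈P → let (i , eq) = covered x in
            Span-resp v eq (covers i (resp (≈ᴹ-sym eq) x∈P))
        }
      where
      greedy : ∀ {k} (e : Vector Carrierᴹ k) →
               ∃₂ λ n (v : Vector Carrierᴹ n) →
                 (∀ i → v i ∈ P) × LinearlyIndependent M v × (∀ i → e i ∈ P → e i ∈ Span M v)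
      greedy {zero}  e = 0 , [] , (λ ()) , (λ _ _ ()) , (λ ())
      greedy {suc k} e with greedy (e ∘ suc) | P? (e zero)
      ... | n , v , v∈ , ind , covers | no e₀∉P =
        n , v , v∈ , ind , λ { zero e₀∈P → contradiction e₀∈P e₀∉P ; (suc i) → covers i }
      ... | n , v , v∈ , ind , covers | yes e₀∈P with Span? v (e zero)
      ...   | yes e₀∈v = n , v , v∈ , ind , λ { zero _ → e₀∈v ; (suc i) → covers i }
      ...   | no  e₀∉v =
        suc n , (e zero ∷ v) , (λ { zero → e₀∈P ; (suc i) → v∈ i }) ,
        ∷-independent ind e₀∉v ,
        λ { zero _ → Span-member (e zero ∷ v) ; (suc i) ei∈P → Span-weaken (e zero) v (covers i ei∈P) }

abstract
  vectorSpace-isFinite : {K : FiniteField c ℓ} (E : VectorSpace K m ℓm) → IsFinite (VectorSpace.module′ E)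
  vectorSpace-isFinite {K = K} E = record
    { _≟ᴹ_    = λ x y → let (a , x≈a) = spanning {x} tt ; (b , y≈b) = spanning {y} tt in
        map′ (λ a≈b → ≈ᴹ-trans x≈a (≈ᴹ-trans (linComb-cong a≈b (λ _ → ≈ᴹ-refl)) (≈ᴹ-sym y≈b)))
             (λ x≈y → linComb-injective independent a b
                        (≈ᴹ-trans (≈ᴹ-sym x≈a) (≈ᴹ-trans x≈y y≈b)))
             (all? (λ i → a i ≟ b i))
    ; size    = order ^ dimension
    ; vector  = λ i → linComb module′ (coefficients i) basis
    ; covered = λ x → let (a , x≈a) = spanning {x} tt in
        code a , ≈ᴹ-sym (≈ᴹ-trans x≈a (linComb-code a basis))
    }
    where
    open FiniteField K using (_≟_; order)
    open VectorSpace E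
    open IsBasis isBasis
    open LinComb module′
    open FiniteModule K module′

  ×-isFinite : {R : Ring c ℓ} {M₁ : LeftModule R m₁ ℓ₁} {M₂ : LeftModule R m₂ ℓ₂} →
               IsFinite M₁ → IsFinite M₂ → IsFinite (leftModule M₁ M₂)
  ×-isFinite {M₁ = M₁} {M₂ = M₂} fin₁ fin₂ = record
    { _≟ᴹ_    = λ (x₁ , x₂) (y₁ , y₂) → (x₁ F₁.≟ᴹ y₁) ×-dec (x₂ F₂.≟ᴹ y₂)
    ; size    = F₁.size ℕ.* F₂.size
    ; vector  = pair ∘ remQuot F₂.size
    ; covered = λ (x₁ , x₂) → let (i₁ , eq₁) = F₁.covered x₁ ; (i₂ , eq₂) = F₂.covered x₂ in
        combine i₁ i₂ ,
        subst (λ r → LeftModule._≈ᴹ_ (leftModule M₁ M₂) (pair r) (x₁ , x₂))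
              (≡.sym (remQuot-combine i₁ i₂)) (eq₁ , eq₂)
    }
    where
    module F₁ = IsFinite fin₁
    module F₂ = IsFinite fin₂
    pair : Fin F₁.size × Fin F₂.size → LeftModule.Carrierᴹ M₁ × LeftModule.Carrierᴹ M₂
    pair (i₁ , i₂) = F₁.vector i₁ , F₂.vector i₂

module _ {K : FiniteField c ℓ} (E : VectorSpace K m ℓm) where

  open VectorSpace E

  -- Subspaces are given by their characteristic functions; as vector spaces
  -- over a finite field are finite, classically every subspace has one.
  record Subspace : Set (c ⊔ m ⊔ ℓm) where
    field
      χ : Carrierᴹ → Bool

    ⟦_⟧ : Pred Carrierᴹ 0ℓ
    ⟦_⟧ = T ∘ χ

    field
      resp : ⟦_⟧ Respects _≈ᴹ_
      0∈   : 0ᴹ ∈ ⟦_⟧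
      +∈   : ∀ {x y} → x ∈ ⟦_⟧ → y ∈ ⟦_⟧ → (x +ᴹ y) ∈ ⟦_⟧
      *∈   : ∀ k {x} → x ∈ ⟦_⟧ → (k *ₗ x) ∈ ⟦_⟧

    _∈? : Decidable ⟦_⟧
    x ∈? = T? (χ x)

  open Subspace using (⟦_⟧)

  comprehension : {P : Pred Carrierᴹ p} → Decidable P → P Respects _≈ᴹ_ → 0ᴹ ∈ P →
                  (∀ {x y} → x ∈ P → y ∈ P → (x +ᴹ y) ∈ P) →
                  (∀ k {x} → x ∈ P → (k *ₗ x) ∈ P) → Subspace
  comprehension P? resp 0∈ +∈ *∈ = record
    { χ    = λ x → ⌊ P? x ⌋
    ; resp = λ x≈y Px → fromWitness (resp x≈y (toWitness Px))
    ; 0∈   = fromWitness 0∈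
    ; +∈   = λ Px Py → fromWitness (+∈ (toWitness Px) (toWitness Py))
    ; *∈   = λ k Px → fromWitness (*∈ k (toWitness Px))
    }

module _ {K : FiniteField c ℓ} {E : VectorSpace K m ℓm} where

  open VectorSpace E
  open Subspace using (⟦_⟧; resp; 0∈; +∈; *∈)
  open FiniteModule K module′
  open BasisExistence K (vectorSpace-isFinite E)
  open IsFinite (vectorSpace-isFinite E) using (∃?; _≟ᴹ_; vector; covered; size)

  -- By independent≤spanning the number n does not depend on the basis.
  dim-exists : (V : Subspace E) → ∃₂ λ n (v : Vector Carrierᴹ n) → IsBasis module′ ⟦ V ⟧ v
  dim-exists V = basis-exists (resp V) (Subspace._∈? V)

  dim : Subspace E → ℕ
  dim V = proj₁ (dim-exists V)

  span : ∀ {n} → Vector Carrierᴹ n → Subspace E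
  span v = comprehension E (Span? v) (Span-resp v) (Span-0 v) (Span-+ v) (Span-* v)

  ∈-span⁻ : ∀ {n} (v : Vector Carrierᴹ n) {x} → x ∈ ⟦ span v ⟧ → Span module′ v x
  ∈-span⁻ v {x} = toWitness {a? = Span? v x}

  ∈-span⁺ : ∀ {n} (v : Vector Carrierᴹ n) {x} → Span module′ v x → x ∈ ⟦ span v ⟧
  ∈-span⁺ v {x} = fromWitness {a? = Span? v x}

  ⟨_⟩ : Carrierᴹ → Subspace E
  ⟨ x ⟩ = span (x ∷ [])

  infixl 6 _+ₛ_
  infixl 7 _∩ₛ_

  _∩ₛ_ : Subspace E → Subspace E → Subspace E
  V ∩ₛ W = comprehension E {P = λ x → x ∈ ⟦ V ⟧ × x ∈ ⟦ W ⟧}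
    (λ x → Subspace._∈? V x ×-dec Subspace._∈? W x)
    (λ x≈y (p , q) → resp V x≈y p , resp W x≈y q)
    (0∈ V , 0∈ W)
    (λ (p , q) (p′ , q′) → +∈ V p p′ , +∈ W q q′)
    (λ k (p , q) → *∈ V k p , *∈ W k q)

  _+ₛ_ : Subspace E → Subspace E → Subspace E
  V +ₛ W = comprehension E {P = λ x → ∃[ v ] v ∈ ⟦ V ⟧ × ∃[ w ] w ∈ ⟦ W ⟧ × x ≈ᴹ v +ᴹ w}
    (λ x → ∃? (λ v≈v′ (v∈ , w , w∈ , eq) → resp V v≈v′ v∈ , w , w∈ , ≈ᴹ-trans eq (+ᴹ-congʳ v≈v′))
      (λ v → Subspace._∈? V v ×-dec
        ∃? (λ w≈w′ (w∈ , eq) → resp W w≈w′ w∈ , ≈ᴹ-trans eq (+ᴹ-congˡ w≈w′))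
          (λ w → Subspace._∈? W w ×-dec (x ≟ᴹ (v +ᴹ w)))))
    (λ x≈y (v , v∈ , w , w∈ , eq) → v , v∈ , w , w∈ , ≈ᴹ-trans (≈ᴹ-sym x≈y) eq)
    (0ᴹ , 0∈ V , 0ᴹ , 0∈ W , ≈ᴹ-sym (+ᴹ-identityˡ 0ᴹ))
    (λ (v , v∈ , w , w∈ , eq) (v′ , v′∈ , w′ , w′∈ , eq′) →
      v +ᴹ v′ , +∈ V v∈ v′∈ , w +ᴹ w′ , +∈ W w∈ w′∈ , ≈ᴹ-trans (+ᴹ-cong eq eq′) (interchange v w v′ w′))
    (λ k (v , v∈ , w , w∈ , eq) →
      k *ₗ v , *∈ V k v∈ , k *ₗ w , *∈ W k w∈ , ≈ᴹ-trans (*ₗ-congˡ eq) (*ₗ-distribˡ k v w))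
    where
    open import Algebra.Properties.CommutativeSemigroup
      (CommutativeMonoid.commutativeSemigroup +ᴹ-commutativeMonoid) using (interchange)

  _⊆?_ : ∀ (V W : Subspace E) → Dec (⟦ V ⟧ ⊆ ⟦ W ⟧)
  V ⊆? W = map′
    (λ sub {x} x∈V → let (i , eq) = covered x in
      resp W eq (sub i (resp V (≈ᴹ-sym eq) x∈V)))
    (λ sub i → sub)
    (all? (λ i → Subspace._∈? V (vector i) →-dec Subspace._∈? W (vector i)))

  dim-mono : ∀ {V W : Subspace E} → ⟦ V ⟧ ⊆ ⟦ W ⟧ → dim V ≤ dim W
  dim-mono {V} {W} V⊆W =
    let (_ , _ , B) = dim-exists V ; (_ , _ , C) = dim-exists W in
    independent≤spanning (IsBasis.independent B) (IsBasis.spanning C ∘ V⊆W ∘ IsBasis.contained B)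

  dim-cong : ∀ {V W : Subspace E} → ⟦ V ⟧ ≐ ⟦ W ⟧ → dim V ≡ dim W
  dim-cong {V} {W} (V⊆W , W⊆V) =
    ℕ.≤-antisym (dim-mono {V} {W} V⊆W) (dim-mono {W} {V} W⊆V)

record IsMinimum {A : Set a} (f : A → ℤ) (P : Pred A p) (μ : ℤ) : Set (a ⊔ p) where
  field
    attained : ∃[ x ] x ∈ P × f x ≡ μ
    bound    : ∀ {x} → x ∈ P → μ ℤ.≤ f x

module _ {K : FiniteField c ℓ} {E : VectorSpace K m ℓm} where

  open VectorSpace E
  open Subspace using (⟦_⟧; resp; 0∈; +∈; *∈)
  open FiniteModule K module′
  open LinComb module′
  open BasisExistence K (vectorSpace-isFinite E)
  open IsFinite (vectorSpace-isFinite E) using (vector; covered; size)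

  spanOf : ∀ n → Fin (size ^ n) → Subspace E
  spanOf n i = span {n = n} (vector ∘ finToFun {size} {n} i)

  spans : ∀ n → List (Subspace E)
  spans n = tabulate (spanOf n)

  subspaces : List (Subspace E)
  subspaces = concatMap (spans ∘ toℕ) (allFin (suc dimension))

  subspaces-complete : (V : Subspace E) → ∃[ W ] W ∈ˡ subspaces × ⟦ W ⟧ ≐ ⟦ V ⟧
  subspaces-complete V = spanOf n i , in-subspaces , ⊆V , V⊆
    where
    n : ℕ
    n = dim V

    v : Vector Carrierᴹ n
    v = proj₁ (proj₂ (dim-exists V))

    v-isBasis : IsBasis module′ ⟦ V ⟧ v
    v-isBasis = proj₂ (proj₂ (dim-exists V))

    i : Fin (size ^ n)
    i = funToFin (λ j → proj₁ (covered (v j)))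

    w : Vector Carrierᴹ n
    w = vector ∘ finToFun {size} {n} i

    w≈v : ∀ j → w j ≈ᴹ v j
    w≈v j = ≈ᴹ-trans (≈ᴹ-reflexive (cong vector (finToFun-funToFin (λ j → proj₁ (covered (v j))) j)))
                     (proj₂ (covered (v j)))

    linComb-w≈v : ∀ a → linComb module′ a w ≈ᴹ linComb module′ a v
    linComb-w≈v a = linComb-cong {a = a} {b = a} (λ _ → FiniteField.refl K) w≈v

    n< : n < suc dimension
    n< = s≤s (independent≤spanning {v = v} {w = basis} (IsBasis.independent v-isBasis)
                                   (λ i → IsBasis.spanning isBasis {v i} tt))

    in-spans : spanOf n i ∈ˡ spans (toℕ (fromℕ< n<))
    in-spans = subst (λ k → spanOf n i ∈ˡ spans k) (≡.sym (toℕ-fromℕ< n<))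
                     (∈-tabulate⁺ {f = spanOf n} i)

    in-subspaces : spanOf n i ∈ˡ subspaces
    in-subspaces = ∈-concatMap⁺ (spans ∘ toℕ) (Any.map in-spans′ (∈-allFin (fromℕ< n<)))
      where
      in-spans′ : ∀ {k} → fromℕ< n< ≡ k → spanOf n i ∈ˡ spans (toℕ k)
      in-spans′ refl = in-spans

    ⊆V : ⟦ spanOf n i ⟧ ⊆ ⟦ V ⟧
    ⊆V x∈ = let (a , eq) = ∈-span⁻ {E = E} w x∈ in
      resp V (≈ᴹ-sym (≈ᴹ-trans eq (linComb-w≈v a)))
             (linComb-closed {P = ⟦ V ⟧} (resp V) (0∈ V) (+∈ V) (*∈ V) a (IsBasis.contained v-isBasis))

    V⊆ : ⟦ V ⟧ ⊆ ⟦ spanOf n i ⟧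
    V⊆ x∈ = let (a , eq) = IsBasis.spanning v-isBasis x∈ in
      ∈-span⁺ {E = E} w (a , ≈ᴹ-trans eq (≈ᴹ-sym (linComb-w≈v a)))

  abstract
    minimum-exists : (V : Subspace E) (f : Subspace E → ℤ) →
                     (∀ {X Y : Subspace E} → ⟦ X ⟧ ≐ ⟦ Y ⟧ → f X ≡ f Y) →
                     ∃[ μ ] IsMinimum f (λ X → ⟦ X ⟧ ⊆ ⟦ V ⟧) μ
    minimum-exists V f f-cong = f Z , record
      { attained = Z , Z⊆V , refl
      ; bound    = λ {X} X⊆V → let (W , W∈ , W⊆X , X⊆W) = subspaces-complete X in
          ℤ.≤-trans (All.lookup (f[argmin]≤f[xs] {f = f} V candidates)
                                (∈-filter⁺ (_⊆? V) W∈ (X⊆V ∘ W⊆X)))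
                    (ℤ.≤-reflexive (f-cong {W} {X} (W⊆X , X⊆W)))
      }
      where
      open Extrema ℤ.≤-totalOrder using (argmin; argmin-all; f[argmin]≤f[xs])
      candidates : List (Subspace E)
      candidates = filter (_⊆? V) subspaces
      Z : Subspace E
      Z = argmin f V candidates
      Z⊆V : ⟦ Z ⟧ ⊆ ⟦ V ⟧
      Z⊆V = argmin-all f {P = λ X → ⟦ X ⟧ ⊆ ⟦ V ⟧} (λ x∈ → x∈) (All.all-filter (_⊆? V) subspaces)

record QMatroid {K : FiniteField c ℓ} (E : VectorSpace K m ℓm) : Set (c ⊔ m ⊔ ℓm) where
  open Subspace using (⟦_⟧)
  field
    ρ          : Subspace E → ℕ
    bounded    : ∀ V → ρ V ≤ dim V
    monotone   : ∀ {V W} → ⟦ V ⟧ ⊆ ⟦ W ⟧ → ρ V ≤ ρ W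
    submodular : ∀ V W → ρ (V +ₛ W) ℕ.+ ρ (V ∩ₛ W) ≤ ρ V ℕ.+ ρ W

  ρ-cong : ∀ {V W} → ⟦ V ⟧ ≐ ⟦ W ⟧ → ρ V ≡ ρ W
  ρ-cong (V⊆W , W⊆V) = ℕ.≤-antisym (monotone V⊆W) (monotone W⊆V)

module _ {K : FiniteField c ℓ} {E : VectorSpace K m ℓm} (M : QMatroid E) where

  open QMatroid M
  open Subspace using (⟦_⟧)

  IsFlat : Pred (Subspace E) m
  IsFlat F = ∀ x → x ∉ ⟦ F ⟧ → ρ F < ρ (F +ₛ ⟨ x ⟩)

  cyc : Subspace E → Pred (VectorSpace.Carrierᴹ E) (c ⊔ m ⊔ ℓm)
  cyc V x = x ∈ ⟦ V ⟧ × (∀ W → ⟦ W ⟧ ⊆ ⟦ V ⟧ → ⟦ W +ₛ ⟨ x ⟩ ⟧ ≐ ⟦ V ⟧ → ρ W ≡ ρ V)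

  IsCyclic : Pred (Subspace E) (c ⊔ m ⊔ ℓm)
  IsCyclic V = cyc V ≐ ⟦ V ⟧

  IsCyclicFlat : Pred (Subspace E) (c ⊔ m ⊔ ℓm)
  IsCyclicFlat Z = IsFlat Z × IsCyclic Z

-- The external direct sum; which basis is carried is immaterial, so one is
-- taken from basis-exists.
_⊕_ : {K : FiniteField c ℓ} → VectorSpace K m₁ ℓ₁ → VectorSpace K m₂ ℓ₂ →
      VectorSpace K (m₁ ⊔ m₂) (ℓ₁ ⊔ ℓ₂)
_⊕_ {K = K} E₁ E₂ = record
  { module′   = leftModule E₁.module′ E₂.module′
  ; dimension = proj₁ B
  ; basis     = proj₁ (proj₂ B)
  ; isBasis   = proj₂ (proj₂ B)
  }
  where
  module E₁ = VectorSpace E₁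
  module E₂ = VectorSpace E₂
  B = BasisExistence.basis-exists K (×-isFinite (vectorSpace-isFinite E₁) (vectorSpace-isFinite E₂))
        {P = U} (λ _ _ → tt) (λ _ → yes tt)

module _ {K : FiniteField c ℓ} {E₁ : VectorSpace K m₁ ℓ₁} {E₂ : VectorSpace K m₂ ℓ₂} where

  private
    module E₁ = VectorSpace E₁
    module E₂ = VectorSpace E₂
    module E = VectorSpace (E₁ ⊕ E₂)
  open Subspace
  open IsFinite (vectorSpace-isFinite (E₁ ⊕ E₂)) using (∃?)

  -- The sum in E₁ ⊕ E₂ of the images of V₁ and V₂.
  _⊕ₛ_ : Subspace E₁ → Subspace E₂ → Subspace (E₁ ⊕ E₂)
  V₁ ⊕ₛ V₂ = comprehension (E₁ ⊕ E₂) {P = ⟦ V₁ ⟧ ⟨×⟩ ⟦ V₂ ⟧}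
    (λ (x₁ , x₂) → Subspace._∈? V₁ x₁ ×-dec Subspace._∈? V₂ x₂)
    (λ (eq₁ , eq₂) (p₁ , p₂) → resp V₁ eq₁ p₁ , resp V₂ eq₂ p₂)
    (0∈ V₁ , 0∈ V₂)
    (λ (p₁ , p₂) (q₁ , q₂) → +∈ V₁ p₁ q₁ , +∈ V₂ p₂ q₂)
    (λ k (p₁ , p₂) → *∈ V₁ k p₁ , *∈ V₂ k p₂)

  π₁ : Subspace (E₁ ⊕ E₂) → Subspace E₁
  π₁ X = comprehension E₁ {P = λ x₁ → ∃[ x ] x ∈ ⟦ X ⟧ × proj₁ x E₁.≈ᴹ x₁}
    (λ x₁ → ∃? (λ x≈y (x∈ , eq) → resp X x≈y x∈ , E₁.≈ᴹ-trans (E₁.≈ᴹ-sym (proj₁ x≈y)) eq)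
               (λ x → Subspace._∈? X x ×-dec IsFinite._≟ᴹ_ (vectorSpace-isFinite E₁) (proj₁ x) x₁))
    (λ eq (x , x∈ , eq′) → x , x∈ , E₁.≈ᴹ-trans eq′ eq)
    (E.0ᴹ , 0∈ X , E₁.≈ᴹ-refl)
    (λ (x , x∈ , eq) (y , y∈ , eq′) → x E.+ᴹ y , +∈ X x∈ y∈ , E₁.+ᴹ-cong eq eq′)
    (λ k (x , x∈ , eq) → k E.*ₗ x , *∈ X k x∈ , E₁.*ₗ-congˡ eq)

  π₂ : Subspace (E₁ ⊕ E₂) → Subspace E₂
  π₂ X = comprehension E₂ {P = λ x₂ → ∃[ x ] x ∈ ⟦ X ⟧ × proj₂ x E₂.≈ᴹ x₂}
    (λ x₂ → ∃? (λ x≈y (x∈ , eq) → resp X x≈y x∈ , E₂.≈ᴹ-trans (E₂.≈ᴹ-sym (proj₂ x≈y)) eq)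
               (λ x → Subspace._∈? X x ×-dec IsFinite._≟ᴹ_ (vectorSpace-isFinite E₂) (proj₂ x) x₂))
    (λ eq (x , x∈ , eq′) → x , x∈ , E₂.≈ᴹ-trans eq′ eq)
    (E.0ᴹ , 0∈ X , E₂.≈ᴹ-refl)
    (λ (x , x∈ , eq) (y , y∈ , eq′) → x E.+ᴹ y , +∈ X x∈ y∈ , E₂.+ᴹ-cong eq eq′)
    (λ k (x , x∈ , eq) → k E.*ₗ x , *∈ X k x∈ , E₂.*ₗ-congˡ eq)

  π₁-mono : ∀ {X Y} → ⟦ X ⟧ ⊆ ⟦ Y ⟧ → ⟦ π₁ X ⟧ ⊆ ⟦ π₁ Y ⟧
  π₁-mono X⊆Y p = let (x , x∈ , eq) = toWitness p in fromWitness (x , X⊆Y x∈ , eq)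

  π₂-mono : ∀ {X Y} → ⟦ X ⟧ ⊆ ⟦ Y ⟧ → ⟦ π₂ X ⟧ ⊆ ⟦ π₂ Y ⟧
  π₂-mono X⊆Y p = let (x , x∈ , eq) = toWitness p in fromWitness (x , X⊆Y x∈ , eq)

  module _ (M₁ : QMatroid E₁) (M₂ : QMatroid E₂) where

    private
      module M₁ = QMatroid M₁
      module M₂ = QMatroid M₂

    -- The quantity minimised over X ≤ V in ρ⊕ V.
    excess : Subspace (E₁ ⊕ E₂) → ℤ
    excess X = + (M₁.ρ (π₁ X) ℕ.+ M₂.ρ (π₂ X)) ℤ.- + dim X

    excess-cong : ∀ {X Y} → ⟦ X ⟧ ≐ ⟦ Y ⟧ → excess X ≡ excess Y
    excess-cong {X} {Y} X≐Y@(X⊆Y , Y⊆X) = cong₂ (λ r d → + r ℤ.- + d)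
      (cong₂ ℕ._+_ (M₁.ρ-cong (π₁-mono {X} {Y} X⊆Y , π₁-mono {Y} {X} Y⊆X))
                   (M₂.ρ-cong (π₂-mono {X} {Y} X⊆Y , π₂-mono {Y} {X} Y⊆X)))
      (dim-cong {V = X} {W = Y} X≐Y)

    minExcess-exists : ∀ V → ∃[ μ ] IsMinimum excess (λ X → ⟦ X ⟧ ⊆ ⟦ V ⟧) μ
    minExcess-exists V = minimum-exists V excess (λ {X} {Y} → excess-cong {X} {Y})

    -- ℤ-valued because the minimum may be negative; that ρ⊕ itself is
    -- nonnegative follows from dim X ≤ dim V for X ≤ V.
    ρ⊕ : Subspace (E₁ ⊕ E₂) → ℤ
    ρ⊕ V = + dim V ℤ.+ proj₁ (minExcess-exists V)

-- Every X ≤ V lies in (π₁ X ⊕ π₂ X) ∩ V, and the box (X₁ ⊕ X₂) ∩ V projects into X₁ and X₂.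
-- Hence the minimum defining ρ(V) is also the minimum of
-- g(X₁ , X₂) = ρ₁(X₁) + ρ₂(X₂) - dim ((X₁ ⊕ X₂) ∩ V) over all pairs of subspaces, and it
-- remains to replace a pair by flats, or by cyclic flats, without increasing g. Closing X₁
-- keeps its rank and enlarges the box. If a flat F₁ is not cyclic, then F₁ = W + ⟨x⟩ for
-- some W ≤ F₁ of smaller rank; passing from F₁ to W lowers the dimension of the box by at
-- most one, so g does not increase. Closing W again keeps the rank below that of F₁, so the
-- process stops, at a cyclic flat.
module Submission where

open import Algebra.Bundles using (CommutativeMonoid)
import Algebra.Properties.CommutativeSemigroup as CommutativeSemigroupProperties
import Algebra.Properties.Ring as RingProperties
open import Data.Fin.Base using (zero; suc)
open import Data.Integer.Base using (ℤ; +_; _+_; _-_)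
open import Data.Integer.Base as ℤ using (_⊖_)
import Data.Integer.Properties as ℤ
import Data.List.Relation.Unary.Any as Any
open import Data.Nat.Base as ℕ using (ℕ; zero; suc; _≤_; _<_; s≤s)
open import Data.Nat.Induction using (<-wellFounded)
import Data.Nat.Properties as ℕ
open import Data.Product using (_×_; _,_; ∃-syntax; proj₁; proj₂)
open import Data.Unit.Base using (tt)
open import Data.Vec.Functional using ([]; _∷_)
open import Defs
open import Function.Base using (_∘_; const; id)
open import Induction.WellFounded using (Acc; acc)
open import Level using (Level)
open import Relation.Binary.PropositionalEquality using (_≡_; refl; sym; trans; cong)
import Relation.Binary.Reasoning.Setoid as SetoidReasoning
open import Relation.Nullary using (¬_; Dec; yes; no; contradiction; ¬?; _×-dec_)
open import Relation.Nullary.Decidable using (decidable-stable; toWitness; fromWitness)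
open import Relation.Unary using (Pred; _⟨×⟩_; _∈_; _∉_; _⊆_)

private
  variable
    c ℓ m ℓm m₁ ℓ₁ m₂ ℓ₂ : Level

-- Comparing differences of natural numbers.

-- Bounds for flats and cyclic flats are proved in `ℕ`, each dimension moved to the opposite side;
-- this carries them to `ℤ`.
-≤- : ∀ m n d e → m ℕ.+ e ≤ n ℕ.+ d → + m - + d ℤ.≤ + n - + e
-≤- m n d e m+e≤n+d = begin
  + m - + d              ≡⟨ ℤ.[+m]-[+n]≡m⊖n m d ⟩
  m ⊖ d                  ≡⟨ ℤ.+-cancelˡ-⊖ e m d ⟨
  (e ℕ.+ m) ⊖ (e ℕ.+ d)  ≡⟨ cong (_⊖ (e ℕ.+ d)) (ℕ.+-comm e m) ⟩
  (m ℕ.+ e) ⊖ (e ℕ.+ d)  ≤⟨ ℤ.⊖-monoˡ-≤ (e ℕ.+ d) m+e≤n+d ⟩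
  (n ℕ.+ d) ⊖ (e ℕ.+ d)  ≡⟨ cong (_⊖ (e ℕ.+ d)) (ℕ.+-comm n d) ⟩
  (d ℕ.+ n) ⊖ (e ℕ.+ d)  ≡⟨ cong ((d ℕ.+ n) ⊖_) (ℕ.+-comm e d) ⟩
  (d ℕ.+ n) ⊖ (d ℕ.+ e)  ≡⟨ ℤ.+-cancelˡ-⊖ d n e ⟩
  n ⊖ e                  ≡⟨ ℤ.[+m]-[+n]≡m⊖n n e ⟨
  + n - + e              ∎
  where open ℤ.≤-Reasoning

+-shiftˡ : ∀ k a b {d e} → a ℕ.+ d ≤ b ℕ.+ e → (k ℕ.+ a) ℕ.+ d ≤ (k ℕ.+ b) ℕ.+ e
+-shiftˡ k a b {d} {e} le = begin
  (k ℕ.+ a) ℕ.+ d  ≡⟨ ℕ.+-assoc k a d ⟩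
  k ℕ.+ (a ℕ.+ d)  ≤⟨ ℕ.+-monoʳ-≤ k le ⟩
  k ℕ.+ (b ℕ.+ e)  ≡⟨ ℕ.+-assoc k b e ⟨
  (k ℕ.+ b) ℕ.+ e  ∎
  where open ℕ.≤-Reasoning

+-shiftʳ : ∀ k a b {d e} → a ℕ.+ d ≤ b ℕ.+ e → (a ℕ.+ k) ℕ.+ d ≤ (b ℕ.+ k) ℕ.+ e
+-shiftʳ k a b {d} {e} le = begin
  (a ℕ.+ k) ℕ.+ d  ≡⟨ cong (ℕ._+ d) (ℕ.+-comm a k) ⟩
  (k ℕ.+ a) ℕ.+ d  ≤⟨ +-shiftˡ k a b le ⟩
  (k ℕ.+ b) ℕ.+ e  ≡⟨ cong (ℕ._+ e) (ℕ.+-comm k b) ⟩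
  (b ℕ.+ k) ℕ.+ e  ∎
  where open ℕ.≤-Reasoning

-- Adjoining one vector to a subspace.

module _ {K : FiniteField c ℓ} {E : VectorSpace K m ℓm} where

  open FiniteField K using (0#; 1#)
  open VectorSpace E
  open Subspace using (⟦_⟧; resp; 0∈; +∈; *∈)
  open FiniteModule K module′
  open BasisExistence K (vectorSpace-isFinite E)

  ∈-+⟨⟩⁻ : (X : Subspace E) {x y : Carrierᴹ} → y ∈ ⟦ X +ₛ ⟨ x ⟩ ⟧ →
           ∃[ w ] w ∈ ⟦ X ⟧ × ∃[ k ] y ≈ᴹ w +ᴹ k *ₗ x
  ∈-+⟨⟩⁻ X {x} y∈ =
    let (w , w∈ , v , v∈ , y≈w+v) = toWitness y∈
        (a , v≈ax) = ∈-span⁻ {E = E} (x ∷ []) v∈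
    in w , w∈ , a zero , ≈ᴹ-trans y≈w+v (+ᴹ-congˡ (≈ᴹ-trans v≈ax (+ᴹ-identityʳ _)))

  ∈-+⟨⟩⁺ : (X : Subspace E) {x y w : Carrierᴹ} → w ∈ ⟦ X ⟧ → ∀ k → y ≈ᴹ w +ᴹ k *ₗ x →
           y ∈ ⟦ X +ₛ ⟨ x ⟩ ⟧
  ∈-+⟨⟩⁺ X {x} {w = w} w∈ k eq = fromWitness
    (w , w∈ , k *ₗ x , ∈-span⁺ {E = E} (x ∷ []) (const k , ≈ᴹ-sym (+ᴹ-identityʳ _)) , eq)

  ⊆-+⟨⟩ : (X : Subspace E) {x : Carrierᴹ} → ⟦ X ⟧ ⊆ ⟦ X +ₛ ⟨ x ⟩ ⟧
  ⊆-+⟨⟩ X {x} {y} y∈ = ∈-+⟨⟩⁺ X y∈ 0#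
    (≈ᴹ-sym (≈ᴹ-trans (+ᴹ-congˡ (*ₗ-zeroˡ x)) (+ᴹ-identityʳ y)))

  ∈-+⟨⟩ : (X : Subspace E) {x : Carrierᴹ} → x ∈ ⟦ X +ₛ ⟨ x ⟩ ⟧
  ∈-+⟨⟩ X {x} = ∈-+⟨⟩⁺ X (0∈ X) 1#
    (≈ᴹ-sym (≈ᴹ-trans (+ᴹ-identityˡ _) (*ₗ-identityˡ x)))

  +⟨⟩-mono : {X Y : Subspace E} {x y : Carrierᴹ} → ⟦ X ⟧ ⊆ ⟦ Y ⟧ → x ≈ᴹ y →
             ⟦ X +ₛ ⟨ x ⟩ ⟧ ⊆ ⟦ Y +ₛ ⟨ y ⟩ ⟧
  +⟨⟩-mono {X} {Y} X⊆Y x≈y z∈ =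
    let (w , w∈ , k , eq) = ∈-+⟨⟩⁻ X z∈ in
    ∈-+⟨⟩⁺ Y (X⊆Y w∈) k (≈ᴹ-trans eq (+ᴹ-congˡ (*ₗ-congˡ x≈y)))

  dim≤dimension : (X : Subspace E) → dim X ≤ dimension
  dim≤dimension X = let (_ , _ , B) = dim-exists X in
    independent≤spanning (IsBasis.independent B) (λ _ → IsBasis.spanning isBasis tt)

  dim-+⟨⟩-≤ : (X : Subspace E) (x : Carrierᴹ) → dim (X +ₛ ⟨ x ⟩) ≤ suc (dim X)
  dim-+⟨⟩-≤ X x =
    let (_ , v , B) = dim-exists X
        (_ , _ , C) = dim-exists (X +ₛ ⟨ x ⟩)
    in independent≤spanning {w = x ∷ v} (IsBasis.independent C) λ i →
      let (w , w∈ , k , eq) = ∈-+⟨⟩⁻ X (IsBasis.contained C i) in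
      Span-resp (x ∷ v) (≈ᴹ-sym eq)
        (Span-+ (x ∷ v) (Span-weaken x v (IsBasis.spanning B w∈))
                        (Span-* (x ∷ v) k (Span-member (x ∷ v))))

  dim-+⟨⟩-> : (X : Subspace E) {x : Carrierᴹ} → x ∉ ⟦ X ⟧ → dim X < dim (X +ₛ ⟨ x ⟩)
  dim-+⟨⟩-> X {x} x∉ =
    let (_ , v , B) = dim-exists X
        (_ , _ , C) = dim-exists (X +ₛ ⟨ x ⟩)
        x∉v : x ∉ Span module′ v
        x∉v = λ (a , eq) → x∉ (resp X (≈ᴹ-sym eq)
          (linComb-closed (resp X) (0∈ X) (+∈ X) (*∈ X) a (IsBasis.contained B)))
    in independent≤spanning {v = x ∷ v} (∷-independent (IsBasis.independent B) x∉v) λ where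
         zero    → IsBasis.spanning C (∈-+⟨⟩ X)
         (suc i) → IsBasis.spanning C (⊆-+⟨⟩ X (IsBasis.contained B i))

-- The exchange argument and the dimension of preimages.

module _ {K : FiniteField c ℓ} (E : VectorSpace K m ℓm) where

  open FiniteField K renaming (_+_ to _+ᴷ_; sym to symᴷ; trans to transᴷ)
  open VectorSpace E
  open CommutativeSemigroupProperties
    (CommutativeMonoid.commutativeSemigroup +ᴹ-commutativeMonoid) using (interchange)

  add-subtract : ∀ x k y → x ≈ᴹ (x +ᴹ k *ₗ y) +ᴹ (- k) *ₗ y
  add-subtract x k y = begin
    x                                ≈⟨ +ᴹ-identityʳ x ⟨
    x +ᴹ 0ᴹ                          ≈⟨ +ᴹ-congˡ (*ₗ-zeroˡ y) ⟨
    x +ᴹ 0# *ₗ y                     ≈⟨ +ᴹ-congˡ (*ₗ-congʳ (-‿inverseʳ k)) ⟨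
    x +ᴹ (k +ᴷ - k) *ₗ y             ≈⟨ +ᴹ-congˡ (*ₗ-distribʳ y k (- k)) ⟩
    x +ᴹ (k *ₗ y +ᴹ (- k) *ₗ y)      ≈⟨ +ᴹ-assoc x _ _ ⟨
    (x +ᴹ k *ₗ y) +ᴹ (- k) *ₗ y      ∎
    where open SetoidReasoning ≈ᴹ-setoid

  -- The multiplier of z is chosen so that the total coefficient of x, `κ - κνμ`, vanishes.
  eliminate : ∀ {x y z u w κ μ ν} → y ≈ᴹ u +ᴹ κ *ₗ x → z ≈ᴹ w +ᴹ μ *ₗ x → μ * ν ≈ 1# →
              y +ᴹ (- (κ * ν)) *ₗ z ≈ᴹ u +ᴹ (- (κ * ν)) *ₗ w
  eliminate {x} {y} {z} {u} {w} {κ} {μ} {ν} y≈ z≈ μν≈1 = begin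
    y +ᴹ k *ₗ z                                ≈⟨ +ᴹ-cong y≈ (*ₗ-congˡ z≈) ⟩
    (u +ᴹ κ *ₗ x) +ᴹ k *ₗ (w +ᴹ μ *ₗ x)        ≈⟨ +ᴹ-congˡ (*ₗ-distribˡ k w _) ⟩
    (u +ᴹ κ *ₗ x) +ᴹ (k *ₗ w +ᴹ k *ₗ (μ *ₗ x)) ≈⟨ interchange u _ _ _ ⟩
    (u +ᴹ k *ₗ w) +ᴹ (κ *ₗ x +ᴹ k *ₗ (μ *ₗ x)) ≈⟨ +ᴹ-congˡ (+ᴹ-congˡ (*ₗ-assoc k μ x)) ⟨
    (u +ᴹ k *ₗ w) +ᴹ (κ *ₗ x +ᴹ (k * μ) *ₗ x)  ≈⟨ +ᴹ-congˡ (*ₗ-distribʳ x κ (k * μ)) ⟨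
    (u +ᴹ k *ₗ w) +ᴹ (κ +ᴷ k * μ) *ₗ x         ≈⟨ +ᴹ-congˡ (*ₗ-congʳ κ+kμ≈0) ⟩
    (u +ᴹ k *ₗ w) +ᴹ 0# *ₗ x                   ≈⟨ +ᴹ-congˡ (*ₗ-zeroˡ x) ⟩
    (u +ᴹ k *ₗ w) +ᴹ 0ᴹ                        ≈⟨ +ᴹ-identityʳ _ ⟩
    u +ᴹ k *ₗ w                                ∎
    where
    open SetoidReasoning ≈ᴹ-setoid
    k : Carrier
    k = - (κ * ν)

    κνμ≈κ : κ * ν * μ ≈ κ
    κνμ≈κ = transᴷ (*-assoc κ ν μ) (transᴷ (*-congˡ (transᴷ (*-comm ν μ) μν≈1)) (*-identityʳ κ))

    κ+kμ≈0 : κ +ᴷ k * μ ≈ 0#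
    κ+kμ≈0 = transᴷ (+-congˡ (transᴷ (symᴷ (RingProperties.-‿distribˡ-* ring (κ * ν) μ)) (-‿cong κνμ≈κ)))
                   (-‿inverseʳ κ)

module _ {K : FiniteField c ℓ} {E : VectorSpace K m ℓm} {E′ : VectorSpace K m₁ ℓ₁} where

  private
    module E = VectorSpace E
    module E′ = VectorSpace E′
  open FiniteField K using (_≈_; 0#; _*_; -_; invertible)
  open Subspace using (⟦_⟧; resp; +∈; *∈)

  module _ {h : E.Carrierᴹ → E′.Carrierᴹ}
           (h-linear : ∀ x k y → h (x E.+ᴹ k E.*ₗ y) E′.≈ᴹ h x E′.+ᴹ k E′.*ₗ h y)
           (A B : Subspace E) (W : Subspace E′) (x : E′.Carrierᴹ)
           (hB⊆W+⟨x⟩ : ∀ {b} → b ∈ ⟦ B ⟧ → h b ∈ ⟦ W +ₛ ⟨ x ⟩ ⟧)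
           (B∩h⁻¹W⊆A : ∀ {b} → b ∈ ⟦ B ⟧ → h b ∈ ⟦ W ⟧ → b ∈ ⟦ A ⟧) where

    -- Since b lies outside A, `h b` has a nonzero coefficient along x. A suitable multiple of b
    -- added to y cancels the x-part of `h y`, so the sum lies in B with image in W, hence in A.
    exchange : ∀ {b} → b ∈ ⟦ B ⟧ → b ∉ ⟦ A ⟧ → ⟦ B ⟧ ⊆ ⟦ A +ₛ ⟨ b ⟩ ⟧
    exchange {b} b∈ b∉ {y} y∈ =
      let (w , w∈ , μ , hb≈w+μx) = ∈-+⟨⟩⁻ W (hB⊆W+⟨x⟩ b∈)
          (u , u∈ , κ , hy≈u+κx) = ∈-+⟨⟩⁻ W (hB⊆W+⟨x⟩ y∈)
          μ≉0 : ¬ μ ≈ 0#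
          μ≉0 μ≈0 = b∉ (B∩h⁻¹W⊆A b∈ (resp W (E′.≈ᴹ-sym (E′.≈ᴹ-trans hb≈w+μx
            (E′.≈ᴹ-trans (E′.+ᴹ-congˡ (E′.≈ᴹ-trans (E′.*ₗ-congʳ μ≈0) (E′.*ₗ-zeroˡ x)))
                         (E′.+ᴹ-identityʳ w)))) w∈))
          (ν , μν≈1) = invertible μ≉0
          k = - (κ * ν)
      in ∈-+⟨⟩⁺ A
        (B∩h⁻¹W⊆A (+∈ B y∈ (*∈ B k b∈))
          (resp W (E′.≈ᴹ-sym (E′.≈ᴹ-trans (h-linear y k b) (eliminate E′ hy≈u+κx hb≈w+μx μν≈1)))
                  (+∈ W u∈ (*∈ W k w∈))))
        (- k) (add-subtract E y k b)

    -- Either some b in B lies outside A, and `exchange` gives B ≤ A + ⟨b⟩, or B ≤ A. It will be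
    -- applied to boxes, with h a projection.
    dim-preimage-≤ : dim B ≤ suc (dim A)
    dim-preimage-≤ with IsFinite.∃? (vectorSpace-isFinite E)
      (λ x≈y (x∈B , x∉A) → resp B x≈y x∈B , x∉A ∘ resp A (E.≈ᴹ-sym x≈y))
      (λ x → Subspace._∈? B x ×-dec ¬? (Subspace._∈? A x))
    ... | yes (b , b∈B , b∉A) =
      ℕ.≤-trans (dim-mono {V = B} {W = A +ₛ ⟨ b ⟩} (exchange b∈B b∉A)) (dim-+⟨⟩-≤ A b)
    ... | no ¬∃ = ℕ.m≤n⇒m≤1+n (dim-mono {V = B} {W = A} λ {x} x∈B →
      decidable-stable (Subspace._∈? A x) λ x∉A → ¬∃ (x , x∈B , x∉A))

-- Passing from a subspace to a flat and to a cyclic flat.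

module _ {K : FiniteField c ℓ} {E : VectorSpace K m ℓm} (M : QMatroid E) where

  open QMatroid M
  open VectorSpace E
  open Subspace using (⟦_⟧; resp)
  open IsFinite (vectorSpace-isFinite E) using (∃?)

  -- Outside vectors that do not raise the rank are adjoined until none remains; each one raises the
  -- dimension, so this stops.
  closure-exists : ∀ X → ∃[ F ] IsFlat M F × ⟦ X ⟧ ⊆ ⟦ F ⟧ × ρ F ≤ ρ X
  -- The first argument is fuel, an upper bound for the codimension of X.
  closure-exists X = go dimension X (ℕ.m≤m+n dimension (dim X))
    where
    Extends : Subspace E → Carrierᴹ → Set
    Extends X x = x ∉ ⟦ X ⟧ × ρ (X +ₛ ⟨ x ⟩) ≤ ρ X

    extends? : ∀ X → Dec (∃[ x ] Extends X x)
    extends? X = ∃?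
      (λ x≈y (x∉X , ρ≤) → x∉X ∘ resp X (≈ᴹ-sym x≈y) ,
        ℕ.≤-trans (monotone (+⟨⟩-mono {X = X} {Y = X} id (≈ᴹ-sym x≈y))) ρ≤)
      (λ x → ¬? (Subspace._∈? X x) ×-dec (ρ (X +ₛ ⟨ x ⟩) ℕ.≤? ρ X))

    go : ∀ n X → dimension ≤ n ℕ.+ dim X → ∃[ F ] IsFlat M F × ⟦ X ⟧ ⊆ ⟦ F ⟧ × ρ F ≤ ρ X
    extend : ∀ n X → dimension ≤ n ℕ.+ dim X → Dec (∃[ x ] Extends X x) →
             ∃[ F ] IsFlat M F × ⟦ X ⟧ ⊆ ⟦ F ⟧ × ρ F ≤ ρ X

    go n X dimension≤ = extend n X dimension≤ (extends? X)

    extend n       X dimension≤ (no ¬∃) =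
      X , (λ x x∉X → ℕ.≰⇒> (λ ρ≤ → ¬∃ (x , x∉X , ρ≤))) , id , ℕ.≤-refl
    -- With no fuel left X has full dimension, leaving no room for a vector outside it.
    extend zero    X dimension≤ (yes (x , x∉X , ρ≤)) = contradiction
      (ℕ.<-≤-trans (dim-+⟨⟩-> X x∉X) (ℕ.≤-trans (dim≤dimension (X +ₛ ⟨ x ⟩)) dimension≤))
      (ℕ.<-irrefl refl)
    extend (suc n) X dimension≤ (yes (x , x∉X , ρ≤)) =
      let (F , flat , X+x⊆F , ρF≤) = go n (X +ₛ ⟨ x ⟩) (begin
            dimension                   ≤⟨ dimension≤ ⟩
            suc (n ℕ.+ dim X)           ≡⟨ ℕ.+-suc n (dim X) ⟨
            n ℕ.+ suc (dim X)           ≤⟨ ℕ.+-monoʳ-≤ n (dim-+⟨⟩-> X x∉X) ⟩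
            n ℕ.+ dim (X +ₛ ⟨ x ⟩)      ∎)
      in F , flat , (λ {y} y∈ → X+x⊆F {y} (⊆-+⟨⟩ X y∈)) , ℕ.≤-trans ρF≤ ρ≤
      where open ℕ.≤-Reasoning

  -- Any W and x that refute cyclicity of X satisfy this. The inclusion is the form that `g-step`
  -- consumes.
  Reduces : Subspace E → Subspace E → Set _
  Reduces W X = ρ W < ρ X × ∃[ x ] ⟦ X ⟧ ⊆ ⟦ W +ₛ ⟨ x ⟩ ⟧

  reduces? : ∀ W X → Dec (Reduces W X)
  reduces? W X = (ρ W ℕ.<? ρ X) ×-dec
    ∃? (λ x≈y X⊆ {z} z∈ → +⟨⟩-mono {X = W} {Y = W} id x≈y (X⊆ z∈))
       (λ x → X ⊆? (W +ₛ ⟨ x ⟩))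

  irreducible⇒cyclic : ∀ X → ¬ Any.Any (λ W → Reduces W X) subspaces → IsCyclic M X
  irreducible⇒cyclic X irreducible = proj₁ , λ {x} x∈X → x∈X , λ W W⊆X W+x≐X →
    ℕ.≤-antisym (monotone {W} {X} W⊆X) (ℕ.≮⇒≥ λ ρW<ρX →
      -- Cyclicity speaks of every W, the search only of listed ones; the listed copy W′ has the
      -- same vectors and inherits the rank drop and the inclusion.
      let (W′ , W′∈ , W′⊆W , W⊆W′) = subspaces-complete W in
      irreducible (Any.map (λ { refl →
        ℕ.≤-<-trans (monotone {W′} {W} W′⊆W) ρW<ρX , x , λ {z} z∈ →
          +⟨⟩-mono {X = W} {Y = W′} W⊆W′ ≈ᴹ-refl (proj₂ W+x≐X z∈) }) W′∈))

  module _ (g : Subspace E → ℕ)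
           (g-mono : ∀ X Y → ⟦ X ⟧ ⊆ ⟦ Y ⟧ → g X ≤ g Y)
           (g-step : ∀ W X x → ⟦ X ⟧ ⊆ ⟦ W +ₛ ⟨ x ⟩ ⟧ → g X ≤ suc (g W)) where

    -- In the application g is the dimension of a box with its other factor fixed. Induction on
    -- rank: X is closed to a flat F, and if some W reduces F, the recursion continues from W, which
    -- need not be flat.
    cyclicFlat-exists : ∀ X → ∃[ Z ] IsCyclicFlat M Z × ρ Z ℕ.+ g X ≤ ρ X ℕ.+ g Z
    cyclicFlat-exists X = go X (<-wellFounded (ρ X))
      where
      open ℕ.≤-Reasoning

      go : ∀ X → Acc _<_ (ρ X) → ∃[ Z ] IsCyclicFlat M Z × ρ Z ℕ.+ g X ≤ ρ X ℕ.+ g Z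
      reduce : ∀ X → Acc _<_ (ρ X) → ∀ F → IsFlat M F → ⟦ X ⟧ ⊆ ⟦ F ⟧ → ρ F ≤ ρ X →
               Dec (Any.Any (λ W → Reduces W F) subspaces) →
               ∃[ Z ] IsCyclicFlat M Z × ρ Z ℕ.+ g X ≤ ρ X ℕ.+ g Z

      go X acc-ρX = let (F , flat , X⊆F , ρF≤ρX) = closure-exists X in
        reduce X acc-ρX F flat X⊆F ρF≤ρX (Any.any? (λ W → reduces? W F) subspaces)

      reduce X _ F flat X⊆F ρF≤ρX (no irreducible) =
        F , (flat , irreducible⇒cyclic F irreducible) , ℕ.+-mono-≤ ρF≤ρX (g-mono X F X⊆F)
      reduce X (acc rec) F flat X⊆F ρF≤ρX (yes reducible) =
        let (W , ρW<ρF , x , F⊆W+x) = Any.satisfied reducible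
            ρW<ρX = ℕ.<-≤-trans ρW<ρF ρF≤ρX
            gX≤1+gW = ℕ.≤-trans (g-mono X F X⊆F) (g-step W F x F⊆W+x)
            (Z , Z-cyclicFlat , le) = go W (rec ρW<ρX)
        in Z , Z-cyclicFlat , (begin
          ρ Z ℕ.+ g X        ≤⟨ ℕ.+-monoʳ-≤ (ρ Z) gX≤1+gW ⟩
          ρ Z ℕ.+ suc (g W)  ≡⟨ ℕ.+-suc (ρ Z) (g W) ⟩
          suc (ρ Z ℕ.+ g W)  ≤⟨ s≤s le ⟩
          -- The unit that g may lose in passing to W is repaid by the strict drop in rank.
          suc (ρ W) ℕ.+ g Z  ≤⟨ ℕ.+-monoˡ-≤ (g Z) ρW<ρX ⟩
          ρ X ℕ.+ g Z        ∎)

-- Boxes in the direct sum.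

module _ {K : FiniteField c ℓ} {E₁ : VectorSpace K m₁ ℓ₁} {E₂ : VectorSpace K m₂ ℓ₂} where

  private
    module E₁ = VectorSpace E₁
    module E₂ = VectorSpace E₂
  open Subspace using (⟦_⟧)

  -- With E₁ and E₂ fixed, as they cannot be inferred from E₁ ⊕ E₂.
  private
    p₁ : Subspace (E₁ ⊕ E₂) → Subspace E₁
    p₁ = π₁ {E₁ = E₁} {E₂ = E₂}

    p₂ : Subspace (E₁ ⊕ E₂) → Subspace E₂
    p₂ = π₂ {E₁ = E₁} {E₂ = E₂}

  ∈-π₁⁺ : ∀ X x → x ∈ ⟦ X ⟧ → proj₁ x ∈ ⟦ p₁ X ⟧
  ∈-π₁⁺ X x x∈ = fromWitness (x , x∈ , E₁.≈ᴹ-refl)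

  ∈-π₂⁺ : ∀ X x → x ∈ ⟦ X ⟧ → proj₂ x ∈ ⟦ p₂ X ⟧
  ∈-π₂⁺ X x x∈ = fromWitness (x , x∈ , E₂.≈ᴹ-refl)

  π₁-⊆ : ∀ X (Y₁ : Subspace E₁) → (∀ x → x ∈ ⟦ X ⟧ → proj₁ x ∈ ⟦ Y₁ ⟧) → ⟦ p₁ X ⟧ ⊆ ⟦ Y₁ ⟧
  π₁-⊆ X Y₁ proj₁∈ x₁∈ = let (x , x∈ , eq) = toWitness x₁∈ in Subspace.resp Y₁ eq (proj₁∈ x x∈)

  π₂-⊆ : ∀ X (Y₂ : Subspace E₂) → (∀ x → x ∈ ⟦ X ⟧ → proj₂ x ∈ ⟦ Y₂ ⟧) → ⟦ p₂ X ⟧ ⊆ ⟦ Y₂ ⟧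
  π₂-⊆ X Y₂ proj₂∈ x₂∈ = let (x , x∈ , eq) = toWitness x₂∈ in Subspace.resp Y₂ eq (proj₂∈ x x∈)

  -- Abstract, since comparing unfolded subspaces is prohibitively slow.
  abstract
    box : Subspace E₁ → Subspace E₂ → Subspace (E₁ ⊕ E₂) → Subspace (E₁ ⊕ E₂)
    box X₁ X₂ V = (X₁ ⊕ₛ X₂) ∩ₛ V

    -- Exported because `box` does not unfold outside this block; it links the abstract form to the
    -- formula of the theorem.
    dim-box : ∀ X₁ X₂ V → dim (box X₁ X₂ V) ≡ dim ((X₁ ⊕ₛ X₂) ∩ₛ V)
    dim-box X₁ X₂ V = refl

    ∈-box⁺ : ∀ X₁ X₂ V x → proj₁ x ∈ ⟦ X₁ ⟧ → proj₂ x ∈ ⟦ X₂ ⟧ → x ∈ ⟦ V ⟧ → x ∈ ⟦ box X₁ X₂ V ⟧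
    ∈-box⁺ X₁ X₂ V x x₁∈ x₂∈ x∈ = fromWitness (fromWitness (x₁∈ , x₂∈) , x∈)

    ∈-box⁻ : ∀ X₁ X₂ V x → x ∈ ⟦ box X₁ X₂ V ⟧ → proj₁ x ∈ ⟦ X₁ ⟧ × proj₂ x ∈ ⟦ X₂ ⟧ × x ∈ ⟦ V ⟧
    ∈-box⁻ X₁ X₂ V x x∈ =
      let (x∈⊕ , x∈V) = toWitness x∈ ; (x₁∈ , x₂∈) = toWitness x∈⊕ in x₁∈ , x₂∈ , x∈V

  module _ (V : Subspace (E₁ ⊕ E₂)) where

    dim-box-mono : ∀ X₁ Y₁ X₂ Y₂ → ⟦ X₁ ⟧ ⊆ ⟦ Y₁ ⟧ → ⟦ X₂ ⟧ ⊆ ⟦ Y₂ ⟧ →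
                   dim (box X₁ X₂ V) ≤ dim (box Y₁ Y₂ V)
    dim-box-mono X₁ Y₁ X₂ Y₂ X₁⊆Y₁ X₂⊆Y₂ =
      dim-mono {K = K} {E = E₁ ⊕ E₂} {V = box X₁ X₂ V} {W = box Y₁ Y₂ V} λ {x} x∈ →
        let (x₁∈ , x₂∈ , x∈V) = ∈-box⁻ X₁ X₂ V x x∈ in
        ∈-box⁺ Y₁ Y₂ V x (X₁⊆Y₁ x₁∈) (X₂⊆Y₂ x₂∈) x∈V

    -- A vector of the larger box belongs to the smaller one once its first component lies in `W₁`,
    -- so `dim-preimage-≤` applies to the first projection.
    dim-box-step₁ : ∀ W₁ X₁ X₂ x₁ → ⟦ X₁ ⟧ ⊆ ⟦ W₁ +ₛ ⟨ x₁ ⟩ ⟧ →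
                    dim (box X₁ X₂ V) ≤ suc (dim (box W₁ X₂ V))
    dim-box-step₁ W₁ X₁ X₂ x₁ X₁⊆ =
      dim-preimage-≤ {K = K} {E = E₁ ⊕ E₂} {E′ = E₁} {h = proj₁} (λ _ _ _ → E₁.≈ᴹ-refl)
        (box W₁ X₂ V) (box X₁ X₂ V) W₁ x₁
        (λ {b} b∈ → X₁⊆ (proj₁ (∈-box⁻ X₁ X₂ V b b∈)))
        (λ {b} b∈ b₁∈ → let (_ , b₂∈ , b∈V) = ∈-box⁻ X₁ X₂ V b b∈ in
          ∈-box⁺ W₁ X₂ V b b₁∈ b₂∈ b∈V)

    dim-box-step₂ : ∀ X₁ W₂ X₂ x₂ → ⟦ X₂ ⟧ ⊆ ⟦ W₂ +ₛ ⟨ x₂ ⟩ ⟧ →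
                    dim (box X₁ X₂ V) ≤ suc (dim (box X₁ W₂ V))
    dim-box-step₂ X₁ W₂ X₂ x₂ X₂⊆ =
      dim-preimage-≤ {K = K} {E = E₁ ⊕ E₂} {E′ = E₂} {h = proj₂} (λ _ _ _ → E₂.≈ᴹ-refl)
        (box X₁ W₂ V) (box X₁ X₂ V) W₂ x₂
        (λ {b} b∈ → X₂⊆ (proj₁ (proj₂ (∈-box⁻ X₁ X₂ V b b∈))))
        (λ {b} b∈ b₂∈ → let (b₁∈ , _ , b∈V) = ∈-box⁻ X₁ X₂ V b b∈ in
          ∈-box⁺ X₁ W₂ V b b₁∈ b₂∈ b∈V)

  -- Comparison of the minima.

  module _ (M₁ : QMatroid E₁) (M₂ : QMatroid E₂) (V : Subspace (E₁ ⊕ E₂)) where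

    open QMatroid M₁ using () renaming (ρ to ρ₁; monotone to monotone₁)
    open QMatroid M₂ using () renaming (ρ to ρ₂; monotone to monotone₂)

    private
      d : Subspace E₁ → Subspace E₂ → ℕ
      d X₁ X₂ = dim (box X₁ X₂ V)

    pairExcess : Subspace E₁ × Subspace E₂ → ℤ
    pairExcess (X₁ , X₂) = + (ρ₁ X₁ ℕ.+ ρ₂ X₂) - + d X₁ X₂

    pairExcess-≤ : ∀ {X₁ X₂ Y₁ Y₂} → ρ₁ X₁ ℕ.+ ρ₂ X₂ ℕ.+ d Y₁ Y₂ ≤ ρ₁ Y₁ ℕ.+ ρ₂ Y₂ ℕ.+ d X₁ X₂ →
                   pairExcess (X₁ , X₂) ℤ.≤ pairExcess (Y₁ , Y₂)
    pairExcess-≤ {X₁} {X₂} {Y₁} {Y₂} =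
      -≤- (ρ₁ X₁ ℕ.+ ρ₂ X₂) (ρ₁ Y₁ ℕ.+ ρ₂ Y₂) (d X₁ X₂) (d Y₁ Y₂)

    excess≤pairExcess : ∀ X₁ X₂ → excess M₁ M₂ (box X₁ X₂ V) ℤ.≤ pairExcess (X₁ , X₂)
    excess≤pairExcess X₁ X₂ = ℤ.+-monoˡ-≤ (ℤ.- + dim X) (ℤ.+≤+ (ℕ.+-mono-≤
      (monotone₁ {p₁ X} {X₁} (π₁-⊆ X X₁ λ x x∈ → proj₁ (∈-box⁻ X₁ X₂ V x x∈)))
      (monotone₂ {p₂ X} {X₂} (π₂-⊆ X X₂ λ x x∈ → proj₁ (proj₂ (∈-box⁻ X₁ X₂ V x x∈))))))
      where
      X : Subspace (E₁ ⊕ E₂)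
      X = box X₁ X₂ V

    pairExcess≤excess : ∀ X → ⟦ X ⟧ ⊆ ⟦ V ⟧ → pairExcess (p₁ X , p₂ X) ℤ.≤ excess M₁ M₂ X
    pairExcess≤excess X X⊆V =
      ℤ.+-monoʳ-≤ (+ (ρ₁ (p₁ X) ℕ.+ ρ₂ (p₂ X))) (ℤ.neg-mono-≤ (ℤ.+≤+
        (dim-mono {K = K} {E = E₁ ⊕ E₂} {V = X} {W = box (p₁ X) (p₂ X) V} λ {x} x∈ →
          ∈-box⁺ (p₁ X) (p₂ X) V x (∈-π₁⁺ X x x∈) (∈-π₂⁺ X x x∈) (X⊆V x∈))))

    -- The minimum μ of `excess` bounds `pairExcess` below on all pairs, because every box lies in
    -- V. The projections of a minimiser have `pairExcess` at most μ, and `below` moves them into P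
    -- without exceeding it.
    minimum-over : ∀ {p} {P : Pred (Subspace E₁ × Subspace E₂) p} {f} →
                   (∀ X → ∃[ Y ] Y ∈ P × pairExcess Y ℤ.≤ pairExcess X) →
                   (∀ X → pairExcess X ≡ f X) →
                   ∃[ μ ] IsMinimum f P μ × ρ⊕ M₁ M₂ V ≡ + dim V + μ
    minimum-over below pairExcess≡f =
      let (μ , min) = minExcess-exists M₁ M₂ V
          (X , X⊆V , excessX≡μ) = IsMinimum.attained min
          (Y , Y∈P , Y≤X) = below (p₁ X , p₂ X)
          μ≤ : ∀ Z → μ ℤ.≤ pairExcess Z
          μ≤ = λ (Z₁ , Z₂) → ℤ.≤-trans
            (IsMinimum.bound min {box Z₁ Z₂ V} λ {x} x∈ → proj₂ (proj₂ (∈-box⁻ Z₁ Z₂ V x x∈)))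
            (excess≤pairExcess Z₁ Z₂)
          Y≤μ = ℤ.≤-trans Y≤X (ℤ.≤-trans (pairExcess≤excess X X⊆V) (ℤ.≤-reflexive excessX≡μ))
      in μ , record
        { attained = Y , Y∈P , trans (sym (pairExcess≡f Y)) (ℤ.≤-antisym Y≤μ (μ≤ Y))
        ; bound    = λ {Z} _ → ℤ.≤-trans (μ≤ Z) (ℤ.≤-reflexive (pairExcess≡f Z))
        -- μ is the very number from which `ρ⊕` is defined.
        } , refl

    flats-below : ∀ X → ∃[ F ] F ∈ (IsFlat M₁ ⟨×⟩ IsFlat M₂) × pairExcess F ℤ.≤ pairExcess X
    flats-below (X₁ , X₂) =
      let (F₁ , flat₁ , X₁⊆F₁ , ρF₁≤) = closure-exists M₁ X₁
          (F₂ , flat₂ , X₂⊆F₂ , ρF₂≤) = closure-exists M₂ X₂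
      in (F₁ , F₂) , (flat₁ , flat₂) , pairExcess-≤ {F₁} {F₂} {X₁} {X₂}
           (ℕ.+-mono-≤ (ℕ.+-mono-≤ ρF₁≤ ρF₂≤) (dim-box-mono V X₁ F₁ X₂ F₂ X₁⊆F₁ X₂⊆F₂))

    -- The factors are replaced one at a time, through the intermediate pair `(Z₁ , X₂)`, so that g
    -- depends on a single subspace.
    cyclicFlats-below : ∀ X → ∃[ Z ] Z ∈ (IsCyclicFlat M₁ ⟨×⟩ IsCyclicFlat M₂) ×
                                     pairExcess Z ℤ.≤ pairExcess X
    cyclicFlats-below (X₁ , X₂) =
      let (Z₁ , cyclicFlat₁ , le₁) = cyclicFlat-exists M₁ (λ Y₁ → d Y₁ X₂)
            (λ W₁ Y₁ W₁⊆Y₁ → dim-box-mono V W₁ Y₁ X₂ X₂ W₁⊆Y₁ id)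
            (λ W₁ Y₁ → dim-box-step₁ V W₁ Y₁ X₂) X₁
          (Z₂ , cyclicFlat₂ , le₂) = cyclicFlat-exists M₂ (d Z₁)
            (λ W₂ Y₂ W₂⊆Y₂ → dim-box-mono V Z₁ Z₁ W₂ Y₂ id W₂⊆Y₂)
            (dim-box-step₂ V Z₁) X₂
      in (Z₁ , Z₂) , (cyclicFlat₁ , cyclicFlat₂) , ℤ.≤-trans
           (pairExcess-≤ {Z₁} {Z₂} {Z₁} {X₂} (+-shiftˡ (ρ₁ Z₁) (ρ₂ Z₂) (ρ₂ X₂) le₂))
           (pairExcess-≤ {Z₁} {X₂} {X₁} {X₂} (+-shiftʳ (ρ₂ X₂) (ρ₁ Z₁) (ρ₁ X₁) le₁))

theorem5p8 : ∀ {c ℓ m₁ ℓ₁ m₂ ℓ₂} {K : FiniteField c ℓ}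
  {E₁ : VectorSpace K m₁ ℓ₁} {E₂ : VectorSpace K m₂ ℓ₂}
  (M₁ : QMatroid E₁) (M₂ : QMatroid E₂) (V : Subspace (E₁ ⊕ E₂)) →
  let open QMatroid M₁ using () renaming (ρ to ρ₁)
      open QMatroid M₂ using () renaming (ρ to ρ₂)
      f : Subspace E₁ × Subspace E₂ → ℤ
      f = λ (X₁ , X₂) → + ρ₁ X₁ + + ρ₂ X₂ - + dim ((X₁ ⊕ₛ X₂) ∩ₛ V)
  in (∃[ μ ] IsMinimum f (IsFlat M₁ ⟨×⟩ IsFlat M₂) μ × ρ⊕ M₁ M₂ V ≡ + dim V + μ)
   × (∃[ μ ] IsMinimum f (IsCyclicFlat M₁ ⟨×⟩ IsCyclicFlat M₂) μ × ρ⊕ M₁ M₂ V ≡ + dim V + μ)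
theorem5p8 M₁ M₂ V =
  minimum-over M₁ M₂ V (flats-below M₁ M₂ V) pairExcess≡ ,
  minimum-over M₁ M₂ V (cyclicFlats-below M₁ M₂ V) pairExcess≡
  where
  open QMatroid M₁ using () renaming (ρ to ρ₁)
  open QMatroid M₂ using () renaming (ρ to ρ₂)

  pairExcess≡ : ∀ X → pairExcess M₁ M₂ V X ≡
                      + ρ₁ (proj₁ X) + + ρ₂ (proj₂ X) - + dim ((proj₁ X ⊕ₛ proj₂ X) ∩ₛ V)
  -- The sum of the two integer ranks computes to the cast of their natural sum, so only the
  -- dimension is rewritten.
  pairExcess≡ (X₁ , X₂) = cong (λ d → + (ρ₁ X₁ ℕ.+ ρ₂ X₂) - + d) (dim-box X₁ X₂ V)
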